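{- The following hold for the system $\mathrm{DC}\mu\nu$ and its duality transformation $(-)^\circ$. (1) If a judgment $J$ is derived from judgments $J_1,\dots,J_n$ ($n=1$ or $2$) by an inference rule $R$ of $\mathrm{DC}\mu\nu$, then $(J)^\circ$ is derived from $(J_n)^\circ,\dots,(J_1)^\circ$ by the inference rule $(R)^\circ$. (2) $((A)^\circ)^\circ=A$, $((D)^\circ)^\circ=D$ and $((J)^\circ)^\circ=J$ for every type $A$, every expression $D$ and every judgment $J$ of $\mathrm{DC}\mu\nu$.
   Context: Syntax. Type variables $X,Y,\dots$ (set $\mathrm{TyVars}$), variables $x,y,z,\dots$ and covariables $\alpha,\beta,\gamma,\dots$ are given, with a fixed involution $(-)'$ between variables and covariables ($x''=x$, $\alpha''=\alpha$). Types of $\mathrm{DC}\mu\nu$: $A::=X\mid A\land A\mid A\lor A\mid\neg A\mid\mu X.A\mid\nu X.A$, where $\mu X.A$ and $\nu X.A$ (binding $X$ in $A$) are formed only if $X\in\mathrm{Pos}(A)$; simultaneously, $\mathrm{Pos}(X)=\mathrm{TyVars}$, $\mathrm{Neg}(X)=\mathrm{TyVars}\setminus\{X\}$, $\mathrm{Pos}(A\land B)=\mathrm{Pos}(A\lor B)=\mathrm{Pos}(A)\cap\mathrm{Pos}(B)$, $\mathrm{Neg}(A\land B)=\mathrm{Neg}(A\lor B)=\mathrm{Neg}(A)\cap\mathrm{Neg}(B)$, $\mathrm{Pos}(\neg A)=\mathrm{Neg}(A)$, $\mathrm{Neg}(\neg A)=\mathrm{Pos}(A)$, $\mathrm{Pos}(\mu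 X.A)=\mathrm{Pos}(\nu X.A)=\mathrm{Pos}(A)\cup\{X\}$, $\mathrm{Neg}(\mu X.A)=\mathrm{Neg}(\nu X.A)=\mathrm{Neg}(A)\cup\{X\}$. Terms: $M::=x\mid\langle M,M\rangle\mid\langle M\rangle\mathsf{inl}\mid\langle M\rangle\mathsf{inr}\mid[K]\mathsf{not}\mid(S).\alpha\mid\mathsf{in}^{\mu X.A}\langle M\rangle\mid\mathsf{coitr}^A_x\langle M,M\rangle$. Coterms: $K::=\alpha\mid[K,K]\mid\mathsf{fst}[K]\mid\mathsf{snd}[K]\mid\mathsf{not}\langle M\rangle\mid x.(S)\mid\mathsf{out}^{\nu X.A}[K]\mid\mathsf{itr}^A_\alpha[K,K]$. Statements: $S::=M\bullet K$. An expression ($D,E,\dots$) is a term ($M,N$), a coterm ($K,L$) or a statement ($S,T$). $(S).\alpha$ binds $\alpha$ in $S$, $x.(S)$ binds $x$ in $S$, $\mathsf{itr}^A_\alpha[K,L]$ binds $\alpha$ in $K$ only, $\mathsf{coitr}^A_x\langle M,N\rangle$ binds $x$ in $M$ only. Types and expressions are identified up to renaming of bound names; substitution is capture-avoiding. Typing. A context $\Gamma$ is a finite set $x_1{:}A_1,\dots,x_n{:}A_n$ of variable declarations, a cocontext $\Delta$ a finite set $\alpha_1{:}B_1,\dots,\alpha_m{:}B_m$ of covariable declarations. Judgments: $\Gamma\vdash\Delta\mid M:A$; $K:A\mid\Gamma\vdash\Delta$; $\Gamma\mid S\vdash\Delta$. Inference rules (premises $\Rightarrow$ conclusion; the order in which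 premises are listed is immaterial): $(AxR)$: $\Gamma,x{:}A\vdash\Delta\mid x:A$. $(AxL)$: $\alpha:A\mid\Gamma\vdash\Delta,\alpha{:}A$. $(\land R)$: $\Gamma\vdash\Delta\mid M:A$, $\Gamma\vdash\Delta\mid N:B$ $\Rightarrow$ $\Gamma\vdash\Delta\mid\langle M,N\rangle:A\land B$. $(\lor L)$: $K:A\mid\Gamma\vdash\Delta$, $L:B\mid\Gamma\vdash\Delta$ $\Rightarrow$ $[K,L]:A\lor B\mid\Gamma\vdash\Delta$. $(\lor R1)$: $\Gamma\vdash\Delta\mid M:A$ $\Rightarrow$ $\Gamma\vdash\Delta\mid\langle M\rangle\mathsf{inl}:A\lor B$. $(\lor R2)$: $\Gamma\vdash\Delta\mid M:B$ $\Rightarrow$ $\Gamma\vdash\Delta\mid\langle M\rangle\mathsf{inr}:A\lor B$. $(\land L1)$: $K:A\mid\Gamma\vdash\Delta$ $\Rightarrow$ $\mathsf{fst}[K]:A\land B\mid\Gamma\vdash\Delta$. $(\land L2)$: $K:B\mid\Gamma\vdash\Delta$ $\Rightarrow$ $\mathsf{snd}[K]:A\land B\mid\Gamma\vdash\Delta$. $(\neg R)$: $K:A\mid\Gamma\vdash\Delta$ $\Rightarrow$ $\Gamma\vdash\Delta\mid[K]\mathsf{not}:\neg A$. $(\neg L)$: $\Gamma\vdash\Delta\mid M:A$ $\Rightarrow$ $\mathsf{not}\langle M\rangle:\neg A\mid\Gamma\vdash\Delta$. $(IR)$: $\Gamma\mid S\vdash\Delta,\alpha{:}A$ $\Rightarrow$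 $\Gamma\vdash\Delta\mid(S).\alpha:A$. $(IL)$: $\Gamma,x{:}A\mid S\vdash\Delta$ $\Rightarrow$ $x.(S):A\mid\Gamma\vdash\Delta$. $(Cut)$: $\Gamma\vdash\Delta\mid M:A$, $K:A\mid\Gamma\vdash\Delta$ $\Rightarrow$ $\Gamma\mid M\bullet K\vdash\Delta$. $(\mu R)$: $\Gamma\vdash\Delta\mid M:A[\mu X.A/X]$ $\Rightarrow$ $\Gamma\vdash\Delta\mid\mathsf{in}^{\mu X.A}\langle M\rangle:\mu X.A$. $(\mu L)$: $K:A[B/X]\mid\Gamma\vdash\Delta,\alpha{:}B$, $L:B\mid\Gamma\vdash\Delta$ $\Rightarrow$ $\mathsf{itr}^B_\alpha[K,L]:\mu X.A\mid\Gamma\vdash\Delta$. $(\nu L)$: $K:A[\nu X.A/X]\mid\Gamma\vdash\Delta$ $\Rightarrow$ $\mathsf{out}^{\nu X.A}[K]:\nu X.A\mid\Gamma\vdash\Delta$. $(\nu R)$: $\Gamma,x{:}B\vdash\Delta\mid M:A[B/X]$, $\Gamma\vdash\Delta\mid N:B$ $\Rightarrow$ $\Gamma\vdash\Delta\mid\mathsf{coitr}^B_x\langle M,N\rangle:\nu X.A$. Duality transformation. Types: $(X)^\circ=X$, $(\neg A)^\circ=\neg(A)^\circ$, $(A\land B)^\circ=(A)^\circ\lor(B)^\circ$, $(A\lor B)^\circ=(A)^\circ\land(B)^\circ$, $(\mu X.A)^\circ=\nu X.(A)^\circ$, $(\nu X.A)^\circ=\mu X.(A)^\circ$. Expressions: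 $(x)^\circ=x'$, $(\alpha)^\circ=\alpha'$, $(\langle M,N\rangle)^\circ=[(M)^\circ,(N)^\circ]$, $([K,L])^\circ=\langle(K)^\circ,(L)^\circ\rangle$, $(\langle M\rangle\mathsf{inl})^\circ=\mathsf{fst}[(M)^\circ]$, $(\mathsf{fst}[K])^\circ=\langle(K)^\circ\rangle\mathsf{inl}$, $(\langle M\rangle\mathsf{inr})^\circ=\mathsf{snd}[(M)^\circ]$, $(\mathsf{snd}[K])^\circ=\langle(K)^\circ\rangle\mathsf{inr}$, $([K]\mathsf{not})^\circ=\mathsf{not}\langle(K)^\circ\rangle$, $(\mathsf{not}\langle M\rangle)^\circ=[(M)^\circ]\mathsf{not}$, $((S).\alpha)^\circ=\alpha'.((S)^\circ)$, $(x.(S))^\circ=((S)^\circ).x'$, $(M\bullet K)^\circ=(K)^\circ\bullet(M)^\circ$, $(\mathsf{in}^{\mu X.A}\langle M\rangle)^\circ=\mathsf{out}^{\nu X.(A)^\circ}[(M)^\circ]$, $(\mathsf{out}^{\nu X.A}[K])^\circ=\mathsf{in}^{\mu X.(A)^\circ}\langle(K)^\circ\rangle$, $(\mathsf{itr}^A_\alpha[K,L])^\circ=\mathsf{coitr}^{(A)^\circ}_{\alpha'}\langle(K)^\circ,(L)^\circ\rangle$, $(\mathsf{coitr}^A_x\langle M,N\rangle)^\circ=\mathsf{itr}^{(A)^\circ}_{x'}[(M)^\circ,(N)^\circ]$. $(\Gamma)^\circ$ and $(\Delta)^\circ$ are obtained by replacing each declaration $x{:}A$ by $x'{:}(A)^\circ$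 and each $\alpha{:}B$ by $\alpha'{:}(B)^\circ$. Judgments: $(\Gamma\vdash\Delta\mid M:A)^\circ$ is $(M)^\circ:(A)^\circ\mid(\Delta)^\circ\vdash(\Gamma)^\circ$; $(K:A\mid\Gamma\vdash\Delta)^\circ$ is $(\Delta)^\circ\vdash(\Gamma)^\circ\mid(K)^\circ:(A)^\circ$; $(\Gamma\mid S\vdash\Delta)^\circ$ is $(\Delta)^\circ\mid(S)^\circ\vdash(\Gamma)^\circ$. Rule names: $(-)^\circ$ exchanges $(AxR)$ with $(AxL)$, $(\land R)$ with $(\lor L)$, $(\lor R1)$ with $(\land L1)$, $(\lor R2)$ with $(\land L2)$, $(\neg R)$ with $(\neg L)$, $(IR)$ with $(IL)$, $(\mu R)$ with $(\nu L)$, $(\mu L)$ with $(\nu R)$, and fixes $(Cut)$. -}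

module Defs where

open import Level using (0ℓ)
open import Data.Bool.Base using (if_then_else_)
open import Data.Empty using (⊥-elim)
open import Data.List.Base using (List; []; _∷_; map)
open import Data.List.Membership.Propositional using (_∈_; _∉_)
open import Data.List.Properties using (map-∘)
open import Data.List.Relation.Binary.BagAndSetEquality using (_∼[_]_; set)
open import Data.List.Relation.Binary.Permutation.Homogeneous using (Permutation)
open import Data.List.Relation.Unary.All.Properties using (¬Any⇒All¬)
open import Data.List.Relation.Unary.AllPairs using (_∷_)
open import Data.List.Relation.Unary.Unique.Propositional using (Unique)
open import Data.List.Relation.Unary.Unique.Propositional.Properties using (map⁺)
open import Data.Maybe.Base as Maybe using (Maybe; just; nothing)
open import Data.Maybe.Properties using (just-injective)
open import Data.Product.Base using (_×_; _,_; proj₁; proj₂; ∃₂)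
open import Data.Sum.Base as Sum using (_⊎_; inj₁; inj₂)
open import Data.Unit.Base using (tt)
open import Function.Base using (_∘_; id)
open import Function.Definitions using (Injective)
open import Relation.Binary.Definitions using (DecidableEquality)
open import Relation.Binary.PropositionalEquality using (_≡_; refl; sym; trans; cong; subst)
open import Relation.Nullary.Decidable.Core using (does)
open import Relation.Unary as Pred using (Pred; U; ∁; ｛_｝; _∩_; _⊢_)

-- The involution between variables and covariables is split into its two
-- halves, _′ᵛ and _′ᶜ.

record Names : Set₁ where
  infix 4 _≟ᵛ_ _≟ᶜ_
  field
    TyVar : Set
    Var   : Set
    CoVar : Set
    _≟ᵛ_  : DecidableEquality Var
    _≟ᶜ_  : DecidableEquality CoVar
    _′ᵛ   : Var → CoVar
    _′ᶜ   : CoVar → Var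
    ′ᵛ′ᶜ  : ∀ x → (x ′ᵛ) ′ᶜ ≡ x
    ′ᶜ′ᵛ  : ∀ α → (α ′ᶜ) ′ᵛ ≡ α

  ′ᵛ-injective : Injective _≡_ _≡_ _′ᵛ
  ′ᵛ-injective {x} {y} eq = trans (sym (′ᵛ′ᶜ x)) (trans (cong _′ᶜ eq) (′ᵛ′ᶜ y))

  ′ᶜ-injective : Injective _≡_ _≡_ _′ᶜ
  ′ᶜ-injective {α} {β} eq = trans (sym (′ᶜ′ᵛ α)) (trans (cong _′ᵛ eq) (′ᶜ′ᵛ β))

-- Types with free type variables in V.  A binder extends V by one element,
-- `nothing`, so that propositional equality is equality up to renaming of
-- bound names: μ A stands for μX.A with `nothing` playing the role of X.
-- The positivity proofs are irrelevant and play no part in equality.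

infixr 7 _∧_
infixr 6 _∨_

data Ty (V : Set) : Set
Pos Neg : ∀ {V} → Ty V → Pred V 0ℓ

data Ty V where
  tvar    : V → Ty V
  _∧_ _∨_ : Ty V → Ty V → Ty V
  ¬_      : Ty V → Ty V
  μ ν     : (A : Ty (Maybe V)) → .(nothing Pred.∈ Pos A) → Ty V

-- In the μ and ν clauses `just ⊢ P` is the preimage of P under just.  The
-- bound variable is not an element of V, so adding it is not visible.

Pos (tvar X) = U
Pos (A ∧ B)  = Pos A ∩ Pos B
Pos (A ∨ B)  = Pos A ∩ Pos B
Pos (¬ A)    = Neg A
Pos (μ A _)  = just ⊢ Pos A
Pos (ν A _)  = just ⊢ Pos A

Neg (tvar X) = ∁ ｛ X ｝
Neg (A ∧ B)  = Neg A ∩ Neg B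
Neg (A ∨ B)  = Neg A ∩ Neg B
Neg (¬ A)    = Pos A
Neg (μ A _)  = just ⊢ Neg A
Neg (ν A _)  = just ⊢ Neg A

private
  lift-map : ∀ {V W : Set} {f : V → W} {P : Pred (Maybe V) 0ℓ} (Y : W) →
             (∀ X → f X ≡ Y → just X Pred.∈ P) →
             ∀ X → Maybe.map f X ≡ just Y → X Pred.∈ P
  lift-map Y h (just X) eq = h X (just-injective eq)

  map-nothing : ∀ {V W : Set} {f : V → W} {P : Pred (Maybe V) 0ℓ} → nothing Pred.∈ P →
                ∀ X → Maybe.map f X ≡ nothing → X Pred.∈ P
  map-nothing p nothing _ = p

renT : ∀ {V W : Set} → (V → W) → Ty V → Ty W
renT-Pos : ∀ {V W : Set} (f : V → W) (A : Ty V) {Y : W} →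
           (∀ X → f X ≡ Y → X Pred.∈ Pos A) → Y Pred.∈ Pos (renT f A)
renT-Neg : ∀ {V W : Set} (f : V → W) (A : Ty V) {Y : W} →
           (∀ X → f X ≡ Y → X Pred.∈ Neg A) → Y Pred.∈ Neg (renT f A)

renT f (tvar X) = tvar (f X)
renT f (A ∧ B)  = renT f A ∧ renT f B
renT f (A ∨ B)  = renT f A ∨ renT f B
renT f (¬ A)    = ¬ renT f A
renT f (μ A p)  = μ (renT (Maybe.map f) A) (renT-Pos (Maybe.map f) A (map-nothing {P = Pos A} p))
renT f (ν A p)  = ν (renT (Maybe.map f) A) (renT-Pos (Maybe.map f) A (map-nothing {P = Pos A} p))

renT-Pos f (tvar X) h = tt
renT-Pos f (A ∧ B)  h = renT-Pos f A (λ X → proj₁ ∘ h X) , renT-Pos f B (λ X → proj₂ ∘ h X)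
renT-Pos f (A ∨ B)  h = renT-Pos f A (λ X → proj₁ ∘ h X) , renT-Pos f B (λ X → proj₂ ∘ h X)
renT-Pos f (¬ A)    h = renT-Neg f A h
renT-Pos f (μ A _)  h = renT-Pos (Maybe.map f) A (lift-map {P = Pos A} _ h)
renT-Pos f (ν A _)  h = renT-Pos (Maybe.map f) A (lift-map {P = Pos A} _ h)

renT-Neg f (tvar X) h = λ eq → h X eq refl
renT-Neg f (A ∧ B)  h = renT-Neg f A (λ X → proj₁ ∘ h X) , renT-Neg f B (λ X → proj₂ ∘ h X)
renT-Neg f (A ∨ B)  h = renT-Neg f A (λ X → proj₁ ∘ h X) , renT-Neg f B (λ X → proj₂ ∘ h X)
renT-Neg f (¬ A)    h = renT-Pos f A h
renT-Neg f (μ A _)  h = renT-Neg (Maybe.map f) A (lift-map {P = Neg A} _ h)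
renT-Neg f (ν A _)  h = renT-Neg (Maybe.map f) A (lift-map {P = Neg A} _ h)

liftT : ∀ {V W : Set} → (V → Ty W) → Maybe V → Ty (Maybe W)
liftT σ nothing  = tvar nothing
liftT σ (just X) = renT just (σ X)

-- `Safe σ Y P X`: either Y is not free in σ X (it is both positive and
-- negative there), or X lies in P and Y is positive in σ X.

private
  Safe : ∀ {V W : Set} → (V → Ty W) → W → Pred V 0ℓ → Pred V 0ℓ
  Safe σ Y P X = (Y Pred.∈ Pos (σ X) × Y Pred.∈ Neg (σ X)) ⊎ (X Pred.∈ P × Y Pred.∈ Pos (σ X))

  mapSafe : ∀ {V W : Set} (σ : V → Ty W) {Y} {P Q : Pred V 0ℓ} → (∀ {X} → X Pred.∈ P → X Pred.∈ Q) →
            (∀ X → Safe σ Y P X) → ∀ X → Safe σ Y Q X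
  mapSafe σ h s X = Sum.map₂ (λ (p , q) → h p , q) (s X)

  lift-just : ∀ {V W : Set} (σ : V → Ty W) {Y} (P : Pred (Maybe V) 0ℓ) →
              (∀ X → Safe σ Y (just ⊢ P) X) → ∀ X → Safe (liftT σ) (just Y) P X
  lift-just σ P s nothing = inj₁ (tt , λ ())
  lift-just σ {Y} P s (just X) with s X
  ... | inj₁ (p , n) = inj₁
    ( renT-Pos just (σ X) (λ Z eq → subst (Pos (σ X)) (sym (just-injective eq)) p)
    , renT-Neg just (σ X) (λ Z eq → subst (Neg (σ X)) (sym (just-injective eq)) n) )
  ... | inj₂ (q , p) = inj₂
    (q , renT-Pos just (σ X) (λ Z eq → subst (Pos (σ X)) (sym (just-injective eq)) p))

  lift-nothing : ∀ {V W : Set} (σ : V → Ty W) (P : Pred (Maybe V) 0ℓ) → nothing Pred.∈ P →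
                 ∀ X → Safe (liftT σ) nothing P X
  lift-nothing σ P p nothing  = inj₂ (p , tt)
  lift-nothing σ P p (just X) =
    inj₁ (renT-Pos just (σ X) (λ _ ()) , renT-Neg just (σ X) (λ _ ()))

subT : ∀ {V W : Set} → (V → Ty W) → Ty V → Ty W
subT-Pos : ∀ {V W : Set} (σ : V → Ty W) (A : Ty V) {Y : W} →
           (∀ X → Safe σ Y (Pos A) X) → Y Pred.∈ Pos (subT σ A)
subT-Neg : ∀ {V W : Set} (σ : V → Ty W) (A : Ty V) {Y : W} →
           (∀ X → Safe σ Y (Neg A) X) → Y Pred.∈ Neg (subT σ A)

subT σ (tvar X) = σ X
subT σ (A ∧ B)  = subT σ A ∧ subT σ B
subT σ (A ∨ B)  = subT σ A ∨ subT σ B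
subT σ (¬ A)    = ¬ subT σ A
subT σ (μ A p)  = μ (subT (liftT σ) A) (subT-Pos (liftT σ) A (lift-nothing σ (Pos A) p))
subT σ (ν A p)  = ν (subT (liftT σ) A) (subT-Pos (liftT σ) A (lift-nothing σ (Pos A) p))

subT-Pos σ (tvar X) s = Sum.[ proj₁ , proj₂ ] (s X)
subT-Pos σ (A ∧ B)  s = subT-Pos σ A (mapSafe σ {P = Pos (A ∧ B)} {Q = Pos A} proj₁ s)
                      , subT-Pos σ B (mapSafe σ {P = Pos (A ∧ B)} {Q = Pos B} proj₂ s)
subT-Pos σ (A ∨ B)  s = subT-Pos σ A (mapSafe σ {P = Pos (A ∨ B)} {Q = Pos A} proj₁ s)
                      , subT-Pos σ B (mapSafe σ {P = Pos (A ∨ B)} {Q = Pos B} proj₂ s)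
subT-Pos σ (¬ A)    s = subT-Neg σ A s
subT-Pos σ (μ A _)  s = subT-Pos (liftT σ) A (lift-just σ (Pos A) s)
subT-Pos σ (ν A _)  s = subT-Pos (liftT σ) A (lift-just σ (Pos A) s)

subT-Neg σ (tvar X) s = Sum.[ proj₂ , (λ (X≢X , _) → ⊥-elim (X≢X refl)) ] (s X)
subT-Neg σ (A ∧ B)  s = subT-Neg σ A (mapSafe σ {P = Neg (A ∧ B)} {Q = Neg A} proj₁ s)
                      , subT-Neg σ B (mapSafe σ {P = Neg (A ∧ B)} {Q = Neg B} proj₂ s)
subT-Neg σ (A ∨ B)  s = subT-Neg σ A (mapSafe σ {P = Neg (A ∨ B)} {Q = Neg A} proj₁ s)
                      , subT-Neg σ B (mapSafe σ {P = Neg (A ∨ B)} {Q = Neg B} proj₂ s)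
subT-Neg σ (¬ A)    s = subT-Pos σ A s
subT-Neg σ (μ A _)  s = subT-Neg (liftT σ) A (lift-just σ (Neg A) s)
subT-Neg σ (ν A _)  s = subT-Neg (liftT σ) A (lift-just σ (Neg A) s)

-- A [ B ] is A[B/X], where X is the variable `nothing` of A.

infix 8 _[_]

_[_] : ∀ {V} → Ty (Maybe V) → Ty V → Ty V
A [ B ] = subT (Maybe.maybe tvar B) A

infix 9 _°ᵗ

_°ᵗ : ∀ {V} → Ty V → Ty V
°ᵗ-Pos : ∀ {V} (A : Ty V) {X : V} → X Pred.∈ Pos A → X Pred.∈ Pos (A °ᵗ)
°ᵗ-Neg : ∀ {V} (A : Ty V) {X : V} → X Pred.∈ Neg A → X Pred.∈ Neg (A °ᵗ)

tvar X  °ᵗ = tvar X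
(A ∧ B) °ᵗ = A °ᵗ ∨ B °ᵗ
(A ∨ B) °ᵗ = A °ᵗ ∧ B °ᵗ
(¬ A)   °ᵗ = ¬ (A °ᵗ)
(μ A p) °ᵗ = ν (A °ᵗ) (°ᵗ-Pos A p)
(ν A p) °ᵗ = μ (A °ᵗ) (°ᵗ-Pos A p)

°ᵗ-Pos (tvar X) p       = p
°ᵗ-Pos (A ∧ B)  (p , q) = °ᵗ-Pos A p , °ᵗ-Pos B q
°ᵗ-Pos (A ∨ B)  (p , q) = °ᵗ-Pos A p , °ᵗ-Pos B q
°ᵗ-Pos (¬ A)    p       = °ᵗ-Neg A p
°ᵗ-Pos (μ A _)  p       = °ᵗ-Pos A p
°ᵗ-Pos (ν A _)  p       = °ᵗ-Pos A p

°ᵗ-Neg (tvar X) p       = p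
°ᵗ-Neg (A ∧ B)  (p , q) = °ᵗ-Neg A p , °ᵗ-Neg B q
°ᵗ-Neg (A ∨ B)  (p , q) = °ᵗ-Neg A p , °ᵗ-Neg B q
°ᵗ-Neg (¬ A)    p       = °ᵗ-Pos A p
°ᵗ-Neg (μ A _)  p       = °ᵗ-Neg A p
°ᵗ-Neg (ν A _)  p       = °ᵗ-Neg A p

data Rule : Set where
  AxR AxL ∧R ∨L ∨R1 ∨R2 ∧L1 ∧L2 ¬R ¬L IR IL Cut μR μL νL νR : Rule

infix 9 _°ʳ

_°ʳ : Rule → Rule
AxR °ʳ = AxL
AxL °ʳ = AxR
∧R  °ʳ = ∨L
∨L  °ʳ = ∧R
∨R1 °ʳ = ∧L1
∧L1 °ʳ = ∨R1
∨R2 °ʳ = ∧L2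
∧L2 °ʳ = ∨R2
¬R  °ʳ = ¬L
¬L  °ʳ = ¬R
IR  °ʳ = IL
IL  °ʳ = IR
Cut °ʳ = Cut
μR  °ʳ = νL
νL  °ʳ = μR
μL  °ʳ = νR
νR  °ʳ = μL

module DCμν (𝒩 : Names) where
  open Names 𝒩

  Type : Set
  Type = Ty TyVar

  -- Raw syntax with free variables in V and free covariables in C; binders
  -- are treated as in Ty.

  data Tm (V C : Set) : Set
  data Co (V C : Set) : Set
  data St (V C : Set) : Set

  infix 5 _•_

  data Tm V C where
    var    : V → Tm V C
    ⟨_,_⟩  : Tm V C → Tm V C → Tm V C
    ⟨_⟩inl : Tm V C → Tm V C
    ⟨_⟩inr : Tm V C → Tm V C
    [_]not : Co V C → Tm V C
    absR   : St V (Maybe C) → Tm V C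
    inμ    : (A : Ty (Maybe TyVar)) → .(nothing Pred.∈ Pos A) → Tm V C → Tm V C
    coitr  : Type → Tm (Maybe V) C → Tm V C → Tm V C

  data Co V C where
    covar  : C → Co V C
    [_,_]  : Co V C → Co V C → Co V C
    fst[_] : Co V C → Co V C
    snd[_] : Co V C → Co V C
    not⟨_⟩ : Tm V C → Co V C
    absL   : St (Maybe V) C → Co V C
    outν   : (A : Ty (Maybe TyVar)) → .(nothing Pred.∈ Pos A) → Co V C → Co V C
    itr    : Type → Co V (Maybe C) → Co V C → Co V C

  data St V C where
    _•_ : Tm V C → Co V C → St V C

  Term Coterm Statement : Set
  Term      = Tm Var CoVar
  Coterm    = Co Var CoVar
  Statement = St Var CoVar

  data Expression : Set where
    term      : Term → Expression
    coterm    : Coterm → Expression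
    statement : Statement → Expression

  renM : ∀ {V C V′ C′} → (V → V′) → (C → C′) → Tm V C → Tm V′ C′
  renK : ∀ {V C V′ C′} → (V → V′) → (C → C′) → Co V C → Co V′ C′
  renS : ∀ {V C V′ C′} → (V → V′) → (C → C′) → St V C → St V′ C′

  renM f g (var x)       = var (f x)
  renM f g ⟨ M , N ⟩     = ⟨ renM f g M , renM f g N ⟩
  renM f g ⟨ M ⟩inl      = ⟨ renM f g M ⟩inl
  renM f g ⟨ M ⟩inr      = ⟨ renM f g M ⟩inr
  renM f g [ K ]not      = [ renK f g K ]not
  renM f g (absR S)      = absR (renS f (Maybe.map g) S)
  renM f g (inμ A p M)   = inμ A p (renM f g M)
  renM f g (coitr A M N) = coitr A (renM (Maybe.map f) g M) (renM f g N)

  renK f g (covar α)     = covar (g α)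
  renK f g [ K , L ]     = [ renK f g K , renK f g L ]
  renK f g fst[ K ]      = fst[ renK f g K ]
  renK f g snd[ K ]      = snd[ renK f g K ]
  renK f g not⟨ M ⟩      = not⟨ renM f g M ⟩
  renK f g (absL S)      = absL (renS (Maybe.map f) g S)
  renK f g (outν A p K)  = outν A p (renK f g K)
  renK f g (itr A K L)   = itr A (renK f (Maybe.map g) K) (renK f g L)

  renS f g (M • K) = renM f g M • renK f g K

  bind : ∀ {N : Set} → DecidableEquality N → N → N → Maybe N
  bind _≟_ x y = if does (x ≟ y) then nothing else just y

  -- The binding forms (S).α, x.(S), itr^A_α[K,L] and coitr^A_x⟨M,N⟩ for a
  -- given name: its free occurrences in the scope become bound.

  ⦅_⦆∙_ : Statement → CoVar → Term
  ⦅ S ⦆∙ α = absR (renS id (bind _≟ᶜ_ α) S)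

  _∙⦅_⦆ : Var → Statement → Coterm
  x ∙⦅ S ⦆ = absL (renS (bind _≟ᵛ_ x) id S)

  itr[_,_][_,_] : Type → CoVar → Coterm → Coterm → Coterm
  itr[ A , α ][ K , L ] = itr A (renK id (bind _≟ᶜ_ α) K) L

  coitr[_,_]⟨_,_⟩ : Type → Var → Term → Term → Term
  coitr[ A , x ]⟨ M , N ⟩ = coitr A (renM (bind _≟ᵛ_ x) id M) N

  -- Finite sets of declarations with pairwise distinct names, represented by
  -- lists; _≋_ is equality of the represented sets.

  record Ctx (N : Set) : Set where
    constructor ctx
    field
      decls     : List (N × Type)
      .distinct : Unique (map proj₁ decls)

  open Ctx public using (decls)

  dom : ∀ {N} → Ctx N → List N
  dom Γ = map proj₁ (decls Γ)

  infix 4 _≋_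

  _≋_ : ∀ {N} → Ctx N → Ctx N → Set
  Γ ≋ Γ′ = decls Γ ∼[ set ] decls Γ′

  infixl 5 _▷_∶_∣_

  _▷_∶_∣_ : ∀ {N} (Γ : Ctx N) (x : N) → Type → .(x ∉ dom Γ) → Ctx N
  ctx Γ u ▷ x ∶ A ∣ x∉Γ = ctx ((x , A) ∷ Γ) (¬Any⇒All¬ _ x∉Γ ∷ u)

  infix 3 _⊢_∣_∶_ _∶_∣_⊢_ _∣_⊢_

  data Judgment : Set where
    _⊢_∣_∶_ : Ctx Var → Ctx CoVar → Term → Type → Judgment
    _∶_∣_⊢_ : Coterm → Type → Ctx Var → Ctx CoVar → Judgment
    _∣_⊢_   : Ctx Var → Statement → Ctx CoVar → Judgment

  infix 4 _≈_

  data _≈_ : Judgment → Judgment → Set where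
    right  : ∀ {Γ Γ′ Δ Δ′ M A} → Γ ≋ Γ′ → Δ ≋ Δ′ → (Γ ⊢ Δ ∣ M ∶ A) ≈ (Γ′ ⊢ Δ′ ∣ M ∶ A)
    left   : ∀ {Γ Γ′ Δ Δ′ K A} → Γ ≋ Γ′ → Δ ≋ Δ′ → (K ∶ A ∣ Γ ⊢ Δ) ≈ (K ∶ A ∣ Γ′ ⊢ Δ′)
    centre : ∀ {Γ Γ′ Δ Δ′ S} → Γ ≋ Γ′ → Δ ≋ Δ′ → (Γ ∣ S ⊢ Δ) ≈ (Γ′ ∣ S ⊢ Δ′)

  -- The inference rules, for one listing of the premises and contexts.

  data Instance : Rule → List Judgment → Judgment → Set where
    axR : ∀ {Γ Δ x A} .(x∉Γ : x ∉ dom Γ) →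
          Instance AxR [] (Γ ▷ x ∶ A ∣ x∉Γ ⊢ Δ ∣ var x ∶ A)
    axL : ∀ {Γ Δ α A} .(α∉Δ : α ∉ dom Δ) →
          Instance AxL [] (covar α ∶ A ∣ Γ ⊢ Δ ▷ α ∶ A ∣ α∉Δ)
    ∧r  : ∀ {Γ Δ M N A B} →
          Instance ∧R ((Γ ⊢ Δ ∣ M ∶ A) ∷ (Γ ⊢ Δ ∣ N ∶ B) ∷ []) (Γ ⊢ Δ ∣ ⟨ M , N ⟩ ∶ A ∧ B)
    ∨l  : ∀ {Γ Δ K L A B} →
          Instance ∨L ((K ∶ A ∣ Γ ⊢ Δ) ∷ (L ∶ B ∣ Γ ⊢ Δ) ∷ []) ([ K , L ] ∶ A ∨ B ∣ Γ ⊢ Δ)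
    ∨r1 : ∀ {Γ Δ M A B} →
          Instance ∨R1 ((Γ ⊢ Δ ∣ M ∶ A) ∷ []) (Γ ⊢ Δ ∣ ⟨ M ⟩inl ∶ A ∨ B)
    ∨r2 : ∀ {Γ Δ M A B} →
          Instance ∨R2 ((Γ ⊢ Δ ∣ M ∶ B) ∷ []) (Γ ⊢ Δ ∣ ⟨ M ⟩inr ∶ A ∨ B)
    ∧l1 : ∀ {Γ Δ K A B} →
          Instance ∧L1 ((K ∶ A ∣ Γ ⊢ Δ) ∷ []) (fst[ K ] ∶ A ∧ B ∣ Γ ⊢ Δ)
    ∧l2 : ∀ {Γ Δ K A B} →
          Instance ∧L2 ((K ∶ B ∣ Γ ⊢ Δ) ∷ []) (snd[ K ] ∶ A ∧ B ∣ Γ ⊢ Δ)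
    ¬r  : ∀ {Γ Δ K A} →
          Instance ¬R ((K ∶ A ∣ Γ ⊢ Δ) ∷ []) (Γ ⊢ Δ ∣ [ K ]not ∶ ¬ A)
    ¬l  : ∀ {Γ Δ M A} →
          Instance ¬L ((Γ ⊢ Δ ∣ M ∶ A) ∷ []) (not⟨ M ⟩ ∶ ¬ A ∣ Γ ⊢ Δ)
    iR  : ∀ {Γ Δ S α A} .(α∉Δ : α ∉ dom Δ) →
          Instance IR ((Γ ∣ S ⊢ Δ ▷ α ∶ A ∣ α∉Δ) ∷ []) (Γ ⊢ Δ ∣ ⦅ S ⦆∙ α ∶ A)
    iL  : ∀ {Γ Δ S x A} .(x∉Γ : x ∉ dom Γ) →
          Instance IL ((Γ ▷ x ∶ A ∣ x∉Γ ∣ S ⊢ Δ) ∷ []) (x ∙⦅ S ⦆ ∶ A ∣ Γ ⊢ Δ)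
    cut : ∀ {Γ Δ M K A} →
          Instance Cut ((Γ ⊢ Δ ∣ M ∶ A) ∷ (K ∶ A ∣ Γ ⊢ Δ) ∷ []) (Γ ∣ M • K ⊢ Δ)
    μr  : ∀ {Γ Δ M A} .(p : nothing Pred.∈ Pos A) →
          Instance μR ((Γ ⊢ Δ ∣ M ∶ A [ μ A p ]) ∷ []) (Γ ⊢ Δ ∣ inμ A p M ∶ μ A p)
    μl  : ∀ {Γ Δ K L A B α} .(p : nothing Pred.∈ Pos A) .(α∉Δ : α ∉ dom Δ) →
          Instance μL ((K ∶ A [ B ] ∣ Γ ⊢ Δ ▷ α ∶ B ∣ α∉Δ) ∷ (L ∶ B ∣ Γ ⊢ Δ) ∷ [])
                      (itr[ B , α ][ K , L ] ∶ μ A p ∣ Γ ⊢ Δ)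
    νl  : ∀ {Γ Δ K A} .(p : nothing Pred.∈ Pos A) →
          Instance νL ((K ∶ A [ ν A p ] ∣ Γ ⊢ Δ) ∷ []) (outν A p K ∶ ν A p ∣ Γ ⊢ Δ)
    νr  : ∀ {Γ Δ M N A B x} .(p : nothing Pred.∈ Pos A) .(x∉Γ : x ∉ dom Γ) →
          Instance νR ((Γ ▷ x ∶ B ∣ x∉Γ ⊢ Δ ∣ M ∶ A [ B ]) ∷ (Γ ⊢ Δ ∣ N ∶ B) ∷ [])
                      (Γ ⊢ Δ ∣ coitr[ B , x ]⟨ M , N ⟩ ∶ ν A p)

  -- Contexts are sets and the order of premises is immaterial, so instances
  -- are closed under _≈_ and under permutation of the premises.

  DerivedBy : Rule → List Judgment → Judgment → Set
  DerivedBy R Js J = ∃₂ λ Js′ J′ → Permutation _≈_ Js Js′ × J ≈ J′ × Instance R Js′ J′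

  -- Duality on expressions.  f and g say how free variables and covariables
  -- are dualized; both act as the identity on names bound on the way.

  dualM : ∀ {V C V′ C′} → (V → C′) → (C → V′) → Tm V C → Co V′ C′
  dualK : ∀ {V C V′ C′} → (V → C′) → (C → V′) → Co V C → Tm V′ C′
  dualS : ∀ {V C V′ C′} → (V → C′) → (C → V′) → St V C → St V′ C′

  dualM f g (var x)       = covar (f x)
  dualM f g ⟨ M , N ⟩     = [ dualM f g M , dualM f g N ]
  dualM f g ⟨ M ⟩inl      = fst[ dualM f g M ]
  dualM f g ⟨ M ⟩inr      = snd[ dualM f g M ]
  dualM f g [ K ]not      = not⟨ dualK f g K ⟩
  dualM f g (absR S)      = absL (dualS f (Maybe.map g) S)
  dualM f g (inμ A p M)   = outν (A °ᵗ) (°ᵗ-Pos A p) (dualM f g M)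
  dualM f g (coitr A M N) = itr (A °ᵗ) (dualM (Maybe.map f) g M) (dualM f g N)

  dualK f g (covar α)     = var (g α)
  dualK f g [ K , L ]     = ⟨ dualK f g K , dualK f g L ⟩
  dualK f g fst[ K ]      = ⟨ dualK f g K ⟩inl
  dualK f g snd[ K ]      = ⟨ dualK f g K ⟩inr
  dualK f g not⟨ M ⟩      = [ dualM f g M ]not
  dualK f g (absL S)      = absR (dualS (Maybe.map f) g S)
  dualK f g (outν A p K)  = inμ (A °ᵗ) (°ᵗ-Pos A p) (dualK f g K)
  dualK f g (itr A K L)   = coitr (A °ᵗ) (dualK f (Maybe.map g) K) (dualK f g L)

  dualS f g (M • K) = dualK f g K • dualM f g M

  infix 9 _°ᴹ _°ᴷ _°ˢ _°ᵉ _°ᵛ _°ᶜ _°ʲ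

  _°ᴹ : Term → Coterm
  _°ᴹ = dualM _′ᵛ _′ᶜ

  _°ᴷ : Coterm → Term
  _°ᴷ = dualK _′ᵛ _′ᶜ

  _°ˢ : Statement → Statement
  _°ˢ = dualS _′ᵛ _′ᶜ

  _°ᵉ : Expression → Expression
  term M      °ᵉ = coterm (M °ᴹ)
  coterm K    °ᵉ = term (K °ᴷ)
  statement S °ᵉ = statement (S °ˢ)

  mapCtx : ∀ {N N′} (f : N → N′) → Injective _≡_ _≡_ f → Ctx N → Ctx N′
  mapCtx {N} f inj (ctx Γ u) = ctx (map h Γ) (subst Unique (names Γ) (map⁺ inj u))
    where
    h : N × Type → _ × Type
    h (x , A) = f x , A °ᵗ

    names : ∀ Γ → map f (map proj₁ Γ) ≡ map proj₁ (map h Γ)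
    names Γ = trans (sym (map-∘ Γ)) (map-∘ Γ)

  _°ᵛ : Ctx Var → Ctx CoVar
  _°ᵛ = mapCtx _′ᵛ ′ᵛ-injective

  _°ᶜ : Ctx CoVar → Ctx Var
  _°ᶜ = mapCtx _′ᶜ ′ᶜ-injective

  _°ʲ : Judgment → Judgment
  (Γ ⊢ Δ ∣ M ∶ A) °ʲ = M °ᴹ ∶ A °ᵗ ∣ Δ °ᶜ ⊢ Γ °ᵛ
  (K ∶ A ∣ Γ ⊢ Δ) °ʲ = Δ °ᶜ ⊢ Γ °ᵛ ∣ K °ᴷ ∶ A °ᵗ
  (Γ ∣ S ⊢ Δ)     °ʲ = Δ °ᶜ ∣ S °ˢ ⊢ Γ °ᵛ

{-# OPTIONS --safe #-}
module Submission where

-- The dual of an instance of R is literally an instance of R°, once duality is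
-- known to commute with type substitution (for the μ and ν rules) and with
-- binding a name (for the rules with binding forms).  The latter holds because
-- (-)′ is injective, so x is captured exactly when x′ is.  The list order of
-- dual premises changes only for Cut.

open import Defs
open import Data.List.Base using (List; []; _∷_; length; map; reverse)
open import Data.List.Membership.Propositional using (_∈_; _∉_)
open import Data.List.Membership.Propositional.Properties using (∈-map⁺; ∈-map⁻)
import Data.List.Properties as List
open import Data.List.Relation.Binary.BagAndSetEquality as BagAndSet using (set)
open import Data.List.Relation.Binary.Permutation.Homogeneous as Permutation
  using (Permutation; refl; prep; swap; trans)
import Data.List.Relation.Binary.Permutation.Propositional as ↭
open import Data.List.Relation.Binary.Permutation.Propositional.Properties using (↭-reverse)
open import Data.List.Relation.Binary.Pointwise as Pointwise using ([])
open import Data.Maybe.Base as Maybe using (Maybe; just; nothing)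
open import Data.Product.Base using (_×_; _,_; proj₁)
open import Data.Sum.Base using (_⊎_)
open import Function.Base using (_∘_; id)
open import Function.Definitions using (Injective)
open import Relation.Binary.Bundles using (Setoid)
open import Relation.Binary.Definitions using (DecidableEquality)
open import Relation.Binary.PropositionalEquality as ≡
  using (_≡_; _≗_; refl; sym; cong; cong₂; subst; module ≡-Reasoning)
open import Relation.Nullary.Decidable.Core using (yes; no)
open import Relation.Nullary.Negation.Core using (contradiction)
import Relation.Unary as Pred

-- Passing under binders, and duality on types.

map-inverse : ∀ {V W : Set} {f : V → W} {g : W → V} → g ∘ f ≗ id → Maybe.map g ∘ Maybe.map f ≗ id
map-inverse gf (just x) = cong just (gf x)
map-inverse gf nothing  = refl

map-square : ∀ {V W X Y : Set} {f : W → Y} {h : V → W} {h′ : X → Y} {f′ : V → X} →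
             f ∘ h ≗ h′ ∘ f′ → Maybe.map f ∘ Maybe.map h ≗ Maybe.map h′ ∘ Maybe.map f′
map-square sq (just x) = cong just (sq x)
map-square sq nothing  = refl

-- Positivity proofs are irrelevant, so once the bodies are identified both sides coincide,
-- whichever proofs they carry.
μ-cong : ∀ {V} {A B : Ty (Maybe V)} .{p : nothing Pred.∈ Pos A} .{q : nothing Pred.∈ Pos B} →
         A ≡ B → μ A p ≡ μ B q
μ-cong refl = refl

ν-cong : ∀ {V} {A B : Ty (Maybe V)} .{p : nothing Pred.∈ Pos A} .{q : nothing Pred.∈ Pos B} →
         A ≡ B → ν A p ≡ ν B q
ν-cong refl = refl

°ᵗ-involutive : ∀ {V} (A : Ty V) → (A °ᵗ) °ᵗ ≡ A
°ᵗ-involutive (tvar X) = refl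
°ᵗ-involutive (A ∧ B)  = cong₂ _∧_ (°ᵗ-involutive A) (°ᵗ-involutive B)
°ᵗ-involutive (A ∨ B)  = cong₂ _∨_ (°ᵗ-involutive A) (°ᵗ-involutive B)
°ᵗ-involutive (¬ A)    = cong ¬_ (°ᵗ-involutive A)
°ᵗ-involutive (μ A p)  = μ-cong (°ᵗ-involutive A)
°ᵗ-involutive (ν A p)  = ν-cong (°ᵗ-involutive A)

°ᵗ-renT : ∀ {V W : Set} (f : V → W) (A : Ty V) → (renT f A) °ᵗ ≡ renT f (A °ᵗ)
°ᵗ-renT f (tvar X) = refl
°ᵗ-renT f (A ∧ B)  = cong₂ _∨_ (°ᵗ-renT f A) (°ᵗ-renT f B)
°ᵗ-renT f (A ∨ B)  = cong₂ _∧_ (°ᵗ-renT f A) (°ᵗ-renT f B)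
°ᵗ-renT f (¬ A)    = cong ¬_ (°ᵗ-renT f A)
°ᵗ-renT f (μ A p)  = ν-cong (°ᵗ-renT (Maybe.map f) A)
°ᵗ-renT f (ν A p)  = μ-cong (°ᵗ-renT (Maybe.map f) A)

°ᵗ-liftT : ∀ {V W : Set} {σ τ : V → Ty W} → _°ᵗ ∘ σ ≗ τ → _°ᵗ ∘ liftT σ ≗ liftT τ
°ᵗ-liftT         στ nothing  = refl
°ᵗ-liftT {σ = σ} στ (just X) = ≡.trans (°ᵗ-renT just (σ X)) (cong (renT just) (στ X))

-- The dual substitution is a separate `τ`, tied to `σ` only pointwise: under a binder `°ᵗ-liftT`
-- re-establishes that relation, and no function extensionality is called for.
°ᵗ-subT : ∀ {V W : Set} {σ τ : V → Ty W} → _°ᵗ ∘ σ ≗ τ →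
          (A : Ty V) → (subT σ A) °ᵗ ≡ subT τ (A °ᵗ)
°ᵗ-subT στ (tvar X) = στ X
°ᵗ-subT στ (A ∧ B)  = cong₂ _∨_ (°ᵗ-subT στ A) (°ᵗ-subT στ B)
°ᵗ-subT στ (A ∨ B)  = cong₂ _∧_ (°ᵗ-subT στ A) (°ᵗ-subT στ B)
°ᵗ-subT στ (¬ A)    = cong ¬_ (°ᵗ-subT στ A)
°ᵗ-subT στ (μ A p)  = ν-cong (°ᵗ-subT (°ᵗ-liftT στ) A)
°ᵗ-subT στ (ν A p)  = μ-cong (°ᵗ-subT (°ᵗ-liftT στ) A)

-- Reconciles the unfolded type in a premise of a fixed-point rule with the one that the dual rule
-- expects.
°ᵗ-[] : ∀ {V} (A : Ty (Maybe V)) (B : Ty V) → (A [ B ]) °ᵗ ≡ (A °ᵗ) [ B °ᵗ ]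
°ᵗ-[] A B = °ᵗ-subT (λ { nothing → refl ; (just X) → refl }) A

module _ (𝒩 : Names) where
  open Names 𝒩
  open DCμν 𝒩

  -- Involutivity on raw expressions.

  inμ-cong : ∀ {V C A B} {M N : Tm V C} .{p : nothing Pred.∈ Pos A} .{q : nothing Pred.∈ Pos B} →
             A ≡ B → M ≡ N → inμ A p M ≡ inμ B q N
  inμ-cong refl refl = refl

  outν-cong : ∀ {V C A B} {K L : Co V C} .{p : nothing Pred.∈ Pos A} .{q : nothing Pred.∈ Pos B} →
              A ≡ B → K ≡ L → outν A p K ≡ outν B q L
  outν-cong refl refl = refl

  coitr-cong : ∀ {V C A A′} {M M′ : Tm (Maybe V) C} {N N′ : Tm V C} →
               A ≡ A′ → M ≡ M′ → N ≡ N′ → coitr A M N ≡ coitr A′ M′ N′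
  coitr-cong refl refl refl = refl

  itr-cong : ∀ {V C A A′} {K K′ : Co V (Maybe C)} {L L′ : Co V C} →
             A ≡ A′ → K ≡ K′ → L ≡ L′ → itr A K L ≡ itr A′ K′ L′
  itr-cong refl refl refl = refl

  module _ where
    private variable
      V C V′ C′ : Set
      f  : V → C′
      g  : C → V′
      f⁻ : C′ → V
      g⁻ : V′ → C

    -- Arbitrary name maps with left inverses replace the two halves of the involution, because
    -- under a binder the maps become `Maybe.map` of themselves. The inverses appear in swapped
    -- order since variables have turned into covariables.
    dualM-inverse : f⁻ ∘ f ≗ id → g⁻ ∘ g ≗ id → ∀ M → dualK g⁻ f⁻ (dualM f g M) ≡ M
    dualK-inverse : f⁻ ∘ f ≗ id → g⁻ ∘ g ≗ id → ∀ K → dualM g⁻ f⁻ (dualK f g K) ≡ K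
    dualS-inverse : f⁻ ∘ f ≗ id → g⁻ ∘ g ≗ id → ∀ S → dualS g⁻ f⁻ (dualS f g S) ≡ S

    dualM-inverse p q (var x)       = cong var (p x)
    dualM-inverse p q ⟨ M , N ⟩     = cong₂ ⟨_,_⟩ (dualM-inverse p q M) (dualM-inverse p q N)
    dualM-inverse p q ⟨ M ⟩inl      = cong ⟨_⟩inl (dualM-inverse p q M)
    dualM-inverse p q ⟨ M ⟩inr      = cong ⟨_⟩inr (dualM-inverse p q M)
    dualM-inverse p q [ K ]not      = cong [_]not (dualK-inverse p q K)
    dualM-inverse p q (absR S)      = cong absR (dualS-inverse p (map-inverse q) S)
    dualM-inverse p q (inμ A _ M)   = inμ-cong (°ᵗ-involutive A) (dualM-inverse p q M)
    dualM-inverse p q (coitr A M N) =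
      coitr-cong (°ᵗ-involutive A) (dualM-inverse (map-inverse p) q M) (dualM-inverse p q N)

    dualK-inverse p q (covar α)    = cong covar (q α)
    dualK-inverse p q [ K , L ]    = cong₂ [_,_] (dualK-inverse p q K) (dualK-inverse p q L)
    dualK-inverse p q fst[ K ]     = cong fst[_] (dualK-inverse p q K)
    dualK-inverse p q snd[ K ]     = cong snd[_] (dualK-inverse p q K)
    dualK-inverse p q not⟨ M ⟩     = cong not⟨_⟩ (dualM-inverse p q M)
    dualK-inverse p q (absL S)     = cong absL (dualS-inverse (map-inverse p) q S)
    dualK-inverse p q (outν A _ K) = outν-cong (°ᵗ-involutive A) (dualK-inverse p q K)
    dualK-inverse p q (itr A K L)  =
      itr-cong (°ᵗ-involutive A) (dualK-inverse p (map-inverse q) K) (dualK-inverse p q L)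

    dualS-inverse p q (M • K) = cong₂ _•_ (dualM-inverse p q M) (dualK-inverse p q K)

  -- Naturality of duality in the names.

  module _ where
    private variable
      V C W D V₁ C₁ W₁ D₁ : Set
      f  : W → D₁
      g  : D → W₁
      f₁ : V → C₁
      g₁ : C → V₁
      h  : V → W
      k  : C → D
      h₁ : C₁ → D₁
      k₁ : V₁ → W₁

    -- The two hypotheses are commuting squares, preserved under binders by `map-square`. Duality
    -- moves variables to the covariable side, hence the order `k₁ h₁` on the right. Renaming leaves
    -- type annotations alone, so only subexpressions need rewriting.
    dualM-ren : f ∘ h ≗ h₁ ∘ f₁ → g ∘ k ≗ k₁ ∘ g₁ → ∀ M →
                dualM f g (renM h k M) ≡ renK k₁ h₁ (dualM f₁ g₁ M)
    dualK-ren : f ∘ h ≗ h₁ ∘ f₁ → g ∘ k ≗ k₁ ∘ g₁ → ∀ K →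
                dualK f g (renK h k K) ≡ renM k₁ h₁ (dualK f₁ g₁ K)
    dualS-ren : f ∘ h ≗ h₁ ∘ f₁ → g ∘ k ≗ k₁ ∘ g₁ → ∀ S →
                dualS f g (renS h k S) ≡ renS k₁ h₁ (dualS f₁ g₁ S)

    dualM-ren p q (var x)       = cong covar (p x)
    dualM-ren p q ⟨ M , N ⟩     = cong₂ [_,_] (dualM-ren p q M) (dualM-ren p q N)
    dualM-ren p q ⟨ M ⟩inl      = cong fst[_] (dualM-ren p q M)
    dualM-ren p q ⟨ M ⟩inr      = cong snd[_] (dualM-ren p q M)
    dualM-ren p q [ K ]not      = cong not⟨_⟩ (dualK-ren p q K)
    dualM-ren p q (absR S)      = cong absL (dualS-ren p (map-square q) S)
    dualM-ren p q (inμ A _ M)   = cong (outν _ _) (dualM-ren p q M)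
    dualM-ren p q (coitr A M N) = cong₂ (itr _) (dualM-ren (map-square p) q M) (dualM-ren p q N)

    dualK-ren p q (covar α)    = cong var (q α)
    dualK-ren p q [ K , L ]    = cong₂ ⟨_,_⟩ (dualK-ren p q K) (dualK-ren p q L)
    dualK-ren p q fst[ K ]     = cong ⟨_⟩inl (dualK-ren p q K)
    dualK-ren p q snd[ K ]     = cong ⟨_⟩inr (dualK-ren p q K)
    dualK-ren p q not⟨ M ⟩     = cong [_]not (dualM-ren p q M)
    dualK-ren p q (absL S)     = cong absR (dualS-ren (map-square p) q S)
    dualK-ren p q (outν A _ K) = cong (inμ _ _) (dualK-ren p q K)
    dualK-ren p q (itr A K L)  = cong₂ (coitr _) (dualK-ren p (map-square q) K) (dualK-ren p q L)

    dualS-ren p q (M • K) = cong₂ _•_ (dualK-ren p q K) (dualM-ren p q M)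

  -- Duality and the binding of a given name.

  map-bind : ∀ {N N′ : Set} (_≟_ : DecidableEquality N) (_≟′_ : DecidableEquality N′) {f : N → N′} →
             Injective _≡_ _≡_ f → ∀ x → Maybe.map f ∘ bind _≟_ x ≗ bind _≟′_ (f x) ∘ f
  map-bind _≟_ _≟′_ {f} inj x y with x ≟ y | f x ≟′ f y
  ... | yes _   | yes _     = refl
  ... | no _    | no _      = refl
  ... | yes x≡y | no fx≢fy  = contradiction (cong f x≡y) fx≢fy
  -- Injectivity excludes this case: without it, dualizing could capture an occurrence that was free
  -- before.
  ... | no x≢y  | yes fx≡fy = contradiction (inj fx≡fy) x≢y

  map-bindᵛ : ∀ x → Maybe.map _′ᵛ ∘ bind _≟ᵛ_ x ≗ bind _≟ᶜ_ (x ′ᵛ) ∘ _′ᵛ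
  map-bindᵛ = map-bind _≟ᵛ_ _≟ᶜ_ ′ᵛ-injective

  map-bindᶜ : ∀ α → Maybe.map _′ᶜ ∘ bind _≟ᶜ_ α ≗ bind _≟ᵛ_ (α ′ᶜ) ∘ _′ᶜ
  map-bindᶜ = map-bind _≟ᶜ_ _≟ᵛ_ ′ᶜ-injective

  -- An instance of naturality. The square for the names not being bound is trivial, and the one for
  -- the bound sort is `map-bindᶜ`.
  absR-° : ∀ S α → (⦅ S ⦆∙ α) °ᴹ ≡ (α ′ᶜ) ∙⦅ S °ˢ ⦆
  absR-° S α = cong absL (dualS-ren (λ _ → refl) (map-bindᶜ α) S)

  absL-° : ∀ x S → (x ∙⦅ S ⦆) °ᴷ ≡ ⦅ S °ˢ ⦆∙ (x ′ᵛ)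
  absL-° x S = cong absR (dualS-ren (map-bindᵛ x) (λ _ → refl) S)

  itr-° : ∀ A α K L → (itr[ A , α ][ K , L ]) °ᴷ ≡ coitr[ A °ᵗ , α ′ᶜ ]⟨ K °ᴷ , L °ᴷ ⟩
  itr-° A α K L = cong (λ M → coitr _ M _) (dualK-ren (λ _ → refl) (map-bindᶜ α) K)

  coitr-° : ∀ A x M N → (coitr[ A , x ]⟨ M , N ⟩) °ᴹ ≡ itr[ A °ᵗ , x ′ᵛ ][ M °ᴹ , N °ᴹ ]
  coitr-° A x M N = cong (λ K → itr _ K _) (dualM-ren (map-bindᵛ x) (λ _ → refl) M)

  -- Involutivity on expressions, contexts and judgments.

  °ᴹ-involutive : ∀ M → (M °ᴹ) °ᴷ ≡ M
  °ᴹ-involutive = dualM-inverse ′ᵛ′ᶜ ′ᶜ′ᵛ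

  °ᴷ-involutive : ∀ K → (K °ᴷ) °ᴹ ≡ K
  °ᴷ-involutive = dualK-inverse ′ᵛ′ᶜ ′ᶜ′ᵛ

  °ˢ-involutive : ∀ S → (S °ˢ) °ˢ ≡ S
  °ˢ-involutive = dualS-inverse ′ᵛ′ᶜ ′ᶜ′ᵛ

  °ᵉ-involutive : ∀ D → (D °ᵉ) °ᵉ ≡ D
  °ᵉ-involutive (term M)      = cong term (°ᴹ-involutive M)
  °ᵉ-involutive (coterm K)    = cong coterm (°ᴷ-involutive K)
  °ᵉ-involutive (statement S) = cong statement (°ˢ-involutive S)

  -- Holds because the distinctness proof is an irrelevant field; equality of contexts thus reduces
  -- to equality of lists.
  decls-injective : ∀ {N} {Γ Γ′ : Ctx N} → decls Γ ≡ decls Γ′ → Γ ≡ Γ′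
  decls-injective refl = refl

  -- A named copy of the local function `h` in `mapCtx`, for use in equational reasoning.
  °ᵈ : ∀ {N N′ : Set} → (N → N′) → N × Type → N′ × Type
  °ᵈ f (x , A) = f x , A °ᵗ

  mapCtx-inverse : ∀ {N N′} {f : N → N′} {g : N′ → N}
                   (f-inj : Injective _≡_ _≡_ f) (g-inj : Injective _≡_ _≡_ g) →
                   g ∘ f ≗ id → mapCtx g g-inj ∘ mapCtx f f-inj ≗ id
  mapCtx-inverse {f = f} {g} f-inj g-inj gf Γ = decls-injective (begin
    map (°ᵈ g) (map (°ᵈ f) (decls Γ)) ≡⟨ List.map-∘ (decls Γ) ⟨
    map (°ᵈ g ∘ °ᵈ f) (decls Γ)       ≡⟨ List.map-cong inverse (decls Γ) ⟩
    map id (decls Γ)                  ≡⟨ List.map-id (decls Γ) ⟩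
    decls Γ                           ∎)
    where
    open ≡-Reasoning
    inverse : °ᵈ g ∘ °ᵈ f ≗ id
    inverse (x , A) = cong₂ _,_ (gf x) (°ᵗ-involutive A)

  mapCtx-≋ : ∀ {N N′} {f : N → N′} (f-inj : Injective _≡_ _≡_ f) {Γ Γ′ : Ctx N} →
             Γ ≋ Γ′ → mapCtx f f-inj Γ ≋ mapCtx f f-inj Γ′
  mapCtx-≋ f-inj = BagAndSet.map-cong (λ _ → refl)

  -- Supplies the freshness side conditions of the dual rules.
  mapCtx-∉ : ∀ {N N′} {f : N → N′} (f-inj : Injective _≡_ _≡_ f) {x} (Γ : Ctx N) →
             x ∉ dom Γ → f x ∉ dom (mapCtx f f-inj Γ)
  -- A clash is traced back twice: from the name to a declaration of the dual context, then to its
  -- preimage in `Γ`, whose name injectivity identifies with `x`.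
  mapCtx-∉ f-inj Γ x∉Γ fx∈ with ∈-map⁻ proj₁ fx∈
  ... | _ , d∈ , fx≡ with ∈-map⁻ _ d∈
  ... | (y , A) , yA∈Γ , refl = x∉Γ (subst (_∈ dom Γ) (sym (f-inj fx≡)) (∈-map⁺ proj₁ yA∈Γ))

  °ᵛ-involutive : ∀ Γ → (Γ °ᵛ) °ᶜ ≡ Γ
  °ᵛ-involutive = mapCtx-inverse ′ᵛ-injective ′ᶜ-injective ′ᵛ′ᶜ

  °ᶜ-involutive : ∀ Δ → (Δ °ᶜ) °ᵛ ≡ Δ
  °ᶜ-involutive = mapCtx-inverse ′ᶜ-injective ′ᵛ-injective ′ᶜ′ᵛ

  right-cong : ∀ {Γ Γ′ Δ Δ′ M M′ A A′} → Γ ≡ Γ′ → Δ ≡ Δ′ → M ≡ M′ → A ≡ A′ →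
               (Γ ⊢ Δ ∣ M ∶ A) ≡ (Γ′ ⊢ Δ′ ∣ M′ ∶ A′)
  right-cong refl refl refl refl = refl

  left-cong : ∀ {Γ Γ′ Δ Δ′ K K′ A A′} → Γ ≡ Γ′ → Δ ≡ Δ′ → K ≡ K′ → A ≡ A′ →
              (K ∶ A ∣ Γ ⊢ Δ) ≡ (K′ ∶ A′ ∣ Γ′ ⊢ Δ′)
  left-cong refl refl refl refl = refl

  centre-cong : ∀ {Γ Γ′ Δ Δ′ S S′} → Γ ≡ Γ′ → Δ ≡ Δ′ → S ≡ S′ →
                (Γ ∣ S ⊢ Δ) ≡ (Γ′ ∣ S′ ⊢ Δ′)
  centre-cong refl refl refl = refl

  °ʲ-involutive : ∀ J → (J °ʲ) °ʲ ≡ J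
  °ʲ-involutive (Γ ⊢ Δ ∣ M ∶ A) =
    right-cong (°ᵛ-involutive Γ) (°ᶜ-involutive Δ) (°ᴹ-involutive M) (°ᵗ-involutive A)
  °ʲ-involutive (K ∶ A ∣ Γ ⊢ Δ) =
    left-cong (°ᵛ-involutive Γ) (°ᶜ-involutive Δ) (°ᴷ-involutive K) (°ᵗ-involutive A)
  °ʲ-involutive (Γ ∣ S ⊢ Δ)     =
    centre-cong (°ᵛ-involutive Γ) (°ᶜ-involutive Δ) (°ˢ-involutive S)

  -- Judgments up to set equality of contexts.

  module _ {A : Set} where
    open Setoid (BagAndSet.[ set ]-Equality A) public
      using () renaming (refl to ∼-refl; trans to ∼-trans)

  ≈-refl : ∀ {J} → J ≈ J
  ≈-refl {Γ ⊢ Δ ∣ M ∶ A} = right (∼-refl {x = decls Γ}) (∼-refl {x = decls Δ})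
  ≈-refl {K ∶ A ∣ Γ ⊢ Δ} = left (∼-refl {x = decls Γ}) (∼-refl {x = decls Δ})
  ≈-refl {Γ ∣ S ⊢ Δ}     = centre (∼-refl {x = decls Γ}) (∼-refl {x = decls Δ})

  ≈-reflexive : ∀ {J J′} → J ≡ J′ → J ≈ J′
  ≈-reflexive refl = ≈-refl

  ≈-trans : ∀ {J J′ J″} → J ≈ J′ → J′ ≈ J″ → J ≈ J″
  ≈-trans (right  p q) (right  r s) = right  (∼-trans p r) (∼-trans q s)
  ≈-trans (left   p q) (left   r s) = left   (∼-trans p r) (∼-trans q s)
  ≈-trans (centre p q) (centre r s) = centre (∼-trans p r) (∼-trans q s)

  °ʲ-≈ : ∀ {J J′} → J ≈ J′ → J °ʲ ≈ J′ °ʲ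
  °ʲ-≈ (right {Γ} {Γ′} {Δ} {Δ′} p q) =
    left (mapCtx-≋ ′ᶜ-injective {Δ} {Δ′} q) (mapCtx-≋ ′ᵛ-injective {Γ} {Γ′} p)
  °ʲ-≈ (left {Γ} {Γ′} {Δ} {Δ′} p q) =
    right (mapCtx-≋ ′ᶜ-injective {Δ} {Δ′} q) (mapCtx-≋ ′ᵛ-injective {Γ} {Γ′} p)
  °ʲ-≈ (centre {Γ} {Γ′} {Δ} {Δ′} p q) =
    centre (mapCtx-≋ ′ᶜ-injective {Δ} {Δ′} q) (mapCtx-≋ ′ᵛ-injective {Γ} {Γ′} p)

  -- Serves the rules whose duals list their premises in the same order; only propositional
  -- rewriting separates the dual judgments from an instance.
  derivedBy : ∀ {R Js Js′ J J′} → Js ≡ Js′ → J ≡ J′ → Instance R Js′ J′ → DerivedBy R Js J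
  derivedBy refl refl r = _ , _ , refl (Pointwise.refl ≈-refl) , ≈-refl , r

  derivedBy-resp : ∀ {R Js Js′ J J′} → Permutation _≈_ Js Js′ → J ≈ J′ →
                   DerivedBy R Js′ J′ → DerivedBy R Js J
  derivedBy-resp Js↭ J≈ (_ , _ , Js′↭ , J′≈ , r) = _ , _ , trans Js↭ Js′↭ , ≈-trans J≈ J′≈ , r

  -- Premises stay in their original order here; the reversal is handled afterwards by a
  -- permutation. Dualizing an extended context computes to the extension of the dual context, so
  -- contexts match by `refl`.
  instance-° : ∀ {R Js J} → Instance R Js J → DerivedBy (R °ʳ) (map _°ʲ Js) (J °ʲ)
  instance-° (axR {Γ} x∉Γ) = derivedBy refl refl (axL {Δ = Γ °ᵛ} (mapCtx-∉ ′ᵛ-injective Γ x∉Γ))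
  instance-° (axL {Δ = Δ} α∉Δ) = derivedBy refl refl (axR {Γ = Δ °ᶜ} (mapCtx-∉ ′ᶜ-injective Δ α∉Δ))
  instance-° ∧r  = derivedBy refl refl ∨l
  instance-° ∨l  = derivedBy refl refl ∧r
  instance-° ∨r1 = derivedBy refl refl ∧l1
  instance-° ∨r2 = derivedBy refl refl ∧l2
  instance-° ∧l1 = derivedBy refl refl ∨r1
  instance-° ∧l2 = derivedBy refl refl ∨r2
  instance-° ¬r  = derivedBy refl refl ¬l
  instance-° ¬l  = derivedBy refl refl ¬r
  instance-° (iR {Δ = Δ} {S} {α} α∉Δ) =
    derivedBy refl (left-cong refl refl (absR-° S α) refl) (iL (mapCtx-∉ ′ᶜ-injective Δ α∉Δ))
  instance-° (iL {Γ} {S = S} {x} x∉Γ) =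
    derivedBy refl (right-cong refl refl (absL-° x S) refl) (iR (mapCtx-∉ ′ᵛ-injective Γ x∉Γ))
  -- The dual of the term premise is a coterm premise, which `cut` lists second.
  instance-° cut = _ , _ , swap ≈-refl ≈-refl (refl []) , ≈-refl , cut
  instance-° (μr {A = A} p) =
    derivedBy (cong (_∷ []) (left-cong refl refl refl (°ᵗ-[] A (μ A p)))) refl (νl (°ᵗ-Pos A p))
  instance-° (νl {A = A} p) =
    derivedBy (cong (_∷ []) (right-cong refl refl refl (°ᵗ-[] A (ν A p)))) refl (μr (°ᵗ-Pos A p))
  -- Two rewrites meet: the substituted type in the first premise, and the bound name in the
  -- conclusion.
  instance-° (μl {Γ} {Δ} {K} {L} {A} {B} {α} p α∉Δ) =
    derivedBy (cong (_∷ (L ∶ B ∣ Γ ⊢ Δ) °ʲ ∷ []) (right-cong refl refl refl (°ᵗ-[] A B)))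
              (right-cong refl refl (itr-° B α K L) refl)
              (νr (°ᵗ-Pos A p) (mapCtx-∉ ′ᶜ-injective Δ α∉Δ))
  instance-° (νr {Γ} {Δ} {M} {N} {A} {B} {x} p x∉Γ) =
    derivedBy (cong (_∷ (Γ ⊢ Δ ∣ N ∶ B) °ʲ ∷ []) (left-cong refl refl refl (°ᵗ-[] A B)))
              (left-cong refl refl (coitr-° B x M N) refl)
              (μl (°ᵗ-Pos A p) (mapCtx-∉ ′ᵛ-injective Γ x∉Γ))

  -- Closure under permutation of premises and equality of contexts.

  °ʲ-↭ : ∀ {Js Js′} → Permutation _≈_ Js Js′ → Permutation _≈_ (map _°ʲ Js) (map _°ʲ Js′)
  °ʲ-↭ (refl ps)    = refl (Pointwise.map⁺ _°ʲ _°ʲ (Pointwise.map °ʲ-≈ ps))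
  °ʲ-↭ (prep e p)   = prep (°ʲ-≈ e) (°ʲ-↭ p)
  °ʲ-↭ (swap d e p) = swap (°ʲ-≈ d) (°ʲ-≈ e) (°ʲ-↭ p)
  °ʲ-↭ (trans p q)  = trans (°ʲ-↭ p) (°ʲ-↭ q)

  reverse-↭ : ∀ Js → Permutation _≈_ (reverse Js) Js
  reverse-↭ Js = Permutation.map ≈-reflexive (↭.↭⇒↭ₛ (↭-reverse Js))

  -- The reversal is undone by one permutation, the dual of the given permutation then leads to the
  -- premises of the dualized instance, and transitivity absorbs both.
  derivedBy-° : ∀ {R Js J} → DerivedBy R Js J → DerivedBy (R °ʳ) (reverse (map _°ʲ Js)) (J °ʲ)
  derivedBy-° (_ , _ , Js↭ , J≈ , r) =
    derivedBy-resp (trans (reverse-↭ _) (°ʲ-↭ Js↭)) (°ʲ-≈ J≈) (instance-° r)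

proposition3p11 : (𝒩 : Names) → let open DCμν 𝒩 in
    ((R : Rule) (Js : List Judgment) (J : Judgment) →
    length Js ≡ 1 ⊎ length Js ≡ 2 →
    DerivedBy R Js J →
    DerivedBy (R °ʳ) (reverse (map _°ʲ Js)) (J °ʲ))
    × ((A : Type) → (A °ᵗ) °ᵗ ≡ A)
    × ((D : Expression) → (D °ᵉ) °ᵉ ≡ D)
    × ((J : Judgment) → (J °ʲ) °ʲ ≡ J)
proposition3p11 𝒩 =
  (λ _ _ _ _ → derivedBy-° 𝒩) , °ᵗ-involutive , °ᵉ-involutive 𝒩 , °ʲ-involutive 𝒩
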